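{- Let $R$ be a relation on $X\times Y$, with both $X$ and $Y$ nonempty. If $\Phi_R$ contains no free faces, then $R$ preserves attribute privacy.
   Context: Everything is finite. A relation $R$ on $X\times Y$ is a subset of $X\times Y$. $Y_x=\{y\in Y:(x,y)\in R\}$ and $X_y=\{x\in X:(x,y)\in R\}$. For $\sigma\subseteq X$, $\phi_R(\sigma)=\bigcap_{x\in\sigma}Y_x$ with $\phi_R(\emptyset)=Y$; for $\gamma\subseteq Y$, $\psi_R(\gamma)=\bigcap_{y\in\gamma}X_y$ with $\psi_R(\emptyset)=X$. $\Phi_R$ is the simplicial complex $\{\gamma\subseteq Y:\exists x\in X\ \forall y\in\gamma\ (x,y)\in R\}$, which contains $\emptyset$ as a simplex. $R$ preserves attribute privacy if $(\phi_R\circ\psi_R)(\gamma)=\gamma$ for all $\gamma\in\Phi_R$ (including $\gamma=\emptyset$). A simplex of a simplicial complex is a free face if it is a proper subset of exactly one maximal simplex of the complex; the empty simplex may be a free face. -}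

module Defs where

open import Data.Fin.Base using (Fin)
open import Data.Fin.Subset using (Subset; _∈_; _⊆_; _⊂_; ⋂)
open import Data.Fin.Subset.Properties using (_∈?_)
open import Data.List.Base using (List; map; filter; allFin)
open import Data.Nat.Base using (ℕ)
open import Data.Product using (∃-syntax; ∃!; _×_; _,_)
open import Data.Vec.Base using (tabulate)
open import Level using (Level; suc)
open import Relation.Binary.Core using (REL)
open import Relation.Binary.Definitions using (Decidable)
open import Relation.Binary.PropositionalEquality.Core using (_≡_)
open import Relation.Nullary.Decidable.Core using (does)
open import Relation.Unary using (Pred)

-- The void complex (no simplices at all) is allowed.
record SimplicialComplex (n : ℕ) (ℓ : Level) : Set (suc ℓ) where
  field
    Simplex : Pred (Subset n) ℓ
    closed  : ∀ {σ τ} → σ ⊆ τ → Simplex τ → Simplex σ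

open SimplicialComplex public

MaximalSimplex : {n : ℕ} {ℓ : Level} → SimplicialComplex n ℓ → Pred (Subset n) ℓ
MaximalSimplex K μ = Simplex K μ × (∀ τ → Simplex K τ → μ ⊆ τ → μ ≡ τ)

FreeFace : {n : ℕ} {ℓ : Level} → SimplicialComplex n ℓ → Pred (Subset n) ℓ
FreeFace K γ = Simplex K γ × ∃! _≡_ (λ μ → MaximalSimplex K μ × γ ⊂ μ)

elements : {n : ℕ} → Subset n → List (Fin n)
elements {n} σ = filter (_∈? σ) (allFin n)

-- A relation between finite sets is taken to be decidable, so that Y_x, X_y,
-- φ_R(σ) and ψ_R(γ) are again elements of the type of finite subsets.
module _ {m n : ℕ} {ℓ : Level} {R : REL (Fin m) (Fin n) ℓ} (R? : Decidable R) where

  row : Fin m → Subset n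
  row x = tabulate (λ y → does (R? x y))

  column : Fin n → Subset m
  column y = tabulate (λ x → does (R? x y))

  -- ⋂ of the empty list is the full subset, so φ ⊥ ≡ ⊤ and ψ ⊥ ≡ ⊤.
  φ : Subset m → Subset n
  φ σ = ⋂ (map row (elements σ))

  ψ : Subset n → Subset m
  ψ γ = ⋂ (map column (elements γ))

Φ : {m n : ℕ} {ℓ : Level} → REL (Fin m) (Fin n) ℓ → SimplicialComplex n ℓ
Φ R = record
  { Simplex = λ γ → ∃[ x ] (∀ y → y ∈ γ → R x y)
  ; closed  = λ σ⊆τ (x , τ⊆Yₓ) → x , λ y y∈σ → τ⊆Yₓ y (σ⊆τ y∈σ)
  }

PreservesAttributePrivacy : {m n : ℕ} {ℓ : Level} {R : REL (Fin m) (Fin n) ℓ} →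
                            Decidable R → Set ℓ
PreservesAttributePrivacy {R = R} R? =
  ∀ γ → Simplex (Φ R) γ → φ R? (ψ R? γ) ≡ γ

{-# OPTIONS --safe #-}

-- If y lies in the closure φ(ψ(γ)), then the star of γ in Φ_R is a cone with
-- apex y: every simplex containing γ stays a simplex when y is added.  Suppose
-- y ∉ γ and enlarge γ to an inclusion-maximal simplex σ avoiding y.  Then any
-- simplex containing σ lies in σ ∪ {y}, so σ ∪ {y} is the only maximal simplex
-- containing σ and σ is a free face.
module Submission where

open import Defs
open import Data.Bool.Base using (true)
open import Data.Fin.Base using (Fin)
open import Data.Fin.Subset
  using (Subset; _∈_; _⊆_; _⊂_; _⊃_; _∪_; ⁅_⁆; ⋂)
open import Data.Fin.Subset.Induction using (Acc; acc; ⊃-wellFounded)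
open import Data.Fin.Subset.Properties
  using (_∈?_; ∈⊤; x∈⁅x⁆; x∈⁅y⁆⇒x≡y; ⊆-antisym; ⊆-trans; x∈p∩q⁺; x∈p∩q⁻
        ; p⊆p∪q; q⊆p∪q; x∈p∪q⁻)
open import Data.List.Base using (List; []; _∷_; map; allFin)
open import Data.List.Membership.Propositional using () renaming (_∈_ to _∈ˡ_)
open import Data.List.Membership.Propositional.Properties
  using (∈-filter⁺; ∈-filter⁻; ∈-allFin)
open import Data.List.Relation.Unary.Any using (here; there)
open import Data.Nat.Base using (ℕ; NonZero)
open import Data.Product using (_,_; proj₁; proj₂)
open import Data.Sum.Base using ([_,_]′)
open import Data.Vec.Base using (tabulate)
open import Data.Vec.Properties using (lookup∘tabulate; []=⇒lookup; lookup⇒[]=)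
open import Function.Base using (_∘_)
open import Level using (Level)
open import Relation.Binary.Core using (REL)
open import Relation.Binary.Definitions using (Decidable)
open import Relation.Binary.PropositionalEquality
  using (_≡_; refl; sym; trans; subst)
open import Relation.Nullary.Decidable using (Dec; yes; no; does; dec-true)
open import Relation.Nullary.Negation.Core using (¬_; contradiction)
open import Relation.Unary using (Pred) renaming (Decidable to Decidable₁)

private
  variable
    m n : ℕ
    ℓ : Level

does-true : {A : Set ℓ} (a? : Dec A) → does a? ≡ true → A
does-true (yes a) _ = a

∈-tabulate-does⁺ : {P : Pred (Fin n) ℓ} (P? : Decidable₁ P) {x : Fin n} →
                   P x → x ∈ tabulate (does ∘ P?)
∈-tabulate-does⁺ P? {x} px =
  lookup⇒[]= x _ (trans (lookup∘tabulate (does ∘ P?) x) (dec-true (P? x) px))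

∈-tabulate-does⁻ : {P : Pred (Fin n) ℓ} (P? : Decidable₁ P) {x : Fin n} →
                   x ∈ tabulate (does ∘ P?) → P x
∈-tabulate-does⁻ P? {x} x∈ =
  does-true (P? x) (trans (sym (lookup∘tabulate (does ∘ P?) x)) ([]=⇒lookup x∈))

∈-⋂-map⁺ : {A : Set} (f : A → Subset n) (xs : List A) {y : Fin n} →
           (∀ {x} → x ∈ˡ xs → y ∈ f x) → y ∈ ⋂ (map f xs)
∈-⋂-map⁺ f []       h = ∈⊤
∈-⋂-map⁺ f (x ∷ xs) h = x∈p∩q⁺ (h (here refl) , ∈-⋂-map⁺ f xs (h ∘ there))

∈-⋂-map⁻ : {A : Set} (f : A → Subset n) (xs : List A) {y : Fin n} →
           y ∈ ⋂ (map f xs) → ∀ {x} → x ∈ˡ xs → y ∈ f x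
∈-⋂-map⁻ f (x ∷ xs) y∈ (here refl) = proj₁ (x∈p∩q⁻ (f x) _ y∈)
∈-⋂-map⁻ f (x ∷ xs) y∈ (there x∈)  =
  ∈-⋂-map⁻ f xs (proj₂ (x∈p∩q⁻ (f x) _ y∈)) x∈

∈-elements⁺ : {σ : Subset n} {x : Fin n} → x ∈ σ → x ∈ˡ elements σ
∈-elements⁺ {σ = σ} {x} = ∈-filter⁺ (_∈? σ) (∈-allFin x)

∈-elements⁻ : {σ : Subset n} {x : Fin n} → x ∈ˡ elements σ → x ∈ σ
∈-elements⁻ {n} {σ} = proj₂ ∘ ∈-filter⁻ (_∈? σ) {xs = allFin n}

module _ {R : REL (Fin m) (Fin n) ℓ} (R? : Decidable R) where

  -- This and the next three lemmas trade the computed subsets for plain facts about `R`, so that no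
  -- later argument unfolds `⋂`, `filter` or `tabulate`.
  ∈-φ⁺ : ∀ {σ y} → (∀ {x} → x ∈ σ → R x y) → y ∈ φ R? σ
  ∈-φ⁺ h = ∈-⋂-map⁺ (row R?) _ λ {x} x∈ →
    ∈-tabulate-does⁺ (R? x) (h (∈-elements⁻ x∈))

  ∈-φ⁻ : ∀ {σ y} → y ∈ φ R? σ → ∀ {x} → x ∈ σ → R x y
  ∈-φ⁻ y∈ {x} x∈ =
    ∈-tabulate-does⁻ (R? x) (∈-⋂-map⁻ (row R?) _ y∈ (∈-elements⁺ x∈))

  ∈-ψ⁺ : ∀ {γ x} → (∀ {y} → y ∈ γ → R x y) → x ∈ ψ R? γ
  ∈-ψ⁺ h = ∈-⋂-map⁺ (column R?) _ λ {y} y∈ →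
    ∈-tabulate-does⁺ (λ x → R? x y) (h (∈-elements⁻ y∈))

  ∈-ψ⁻ : ∀ {γ x} → x ∈ ψ R? γ → ∀ {y} → y ∈ γ → R x y
  ∈-ψ⁻ x∈ {y} y∈ =
    ∈-tabulate-does⁻ (λ x → R? x y) (∈-⋂-map⁻ (column R?) _ x∈ (∈-elements⁺ y∈))

∪-⊆ : {p q r : Subset n} → p ⊆ r → q ⊆ r → p ∪ q ⊆ r
∪-⊆ {p = p} {q} p⊆r q⊆r = [ p⊆r , q⊆r ]′ ∘ x∈p∪q⁻ p q

⁅⁆-⊆ : {x : Fin n} {p : Subset n} → x ∈ p → ⁅ x ⁆ ⊆ p
⁅⁆-⊆ {x = x} {p} x∈p y∈ = subst (_∈ p) (sym (x∈⁅y⁆⇒x≡y x y∈)) x∈p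

x∈p∪⁅x⁆ : (p : Subset n) (x : Fin n) → x ∈ p ∪ ⁅ x ⁆
x∈p∪⁅x⁆ p x = q⊆p∪q p ⁅ x ⁆ (x∈⁅x⁆ x)

module _ (K : SimplicialComplex n ℓ) (v : Fin n) where

  -- Quantifying over every simplex above `σ` makes the condition pass to supersets of `σ`, as the
  -- induction below requires.
  StarIsCone : Subset n → Set ℓ
  StarIsCone σ = ∀ {τ} → Simplex K τ → σ ⊆ τ → Simplex K (τ ∪ ⁅ v ⁆)

  -- The last hypothesis says that the link of `σ` has no vertex other than `v`. The simplices above
  -- `σ` are therefore bounded by `σ ∪ ⁅ v ⁆`, itself a simplex by the cone condition.
  freeFace : ∀ {σ} → Simplex K σ → StarIsCone σ → ¬ v ∈ σ →
             (∀ {w} → Simplex K (σ ∪ ⁅ w ⁆) → w ∈ σ ∪ ⁅ v ⁆) →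
             FreeFace K σ
  freeFace {σ} Kσ cone v∉σ saturated =
    Kσ , μ , ((Kμ , μ-maximal) , (σ⊆μ , v , x∈p∪⁅x⁆ σ v , v∉σ)) , unique
    where
    μ : Subset n
    μ = σ ∪ ⁅ v ⁆

    σ⊆μ : σ ⊆ μ
    σ⊆μ = p⊆p∪q ⁅ v ⁆

    Kμ : Simplex K μ
    Kμ = cone Kσ (λ x∈ → x∈)

    simplex⊆μ : ∀ {τ} → Simplex K τ → σ ⊆ τ → τ ⊆ μ
    -- For each `w` in `τ`, the set `σ ∪ ⁅ w ⁆` is a face of `τ`, so a test on single vertices
    -- bounds all of `τ`.
    simplex⊆μ Kτ σ⊆τ w∈τ = saturated (closed K (∪-⊆ σ⊆τ (⁅⁆-⊆ w∈τ)) Kτ)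

    μ-maximal : ∀ τ → Simplex K τ → μ ⊆ τ → μ ≡ τ
    μ-maximal τ Kτ μ⊆τ = ⊆-antisym μ⊆τ (simplex⊆μ Kτ (⊆-trans σ⊆μ μ⊆τ))

    unique : ∀ {ν} → _ → μ ≡ ν
    unique ((Kν , ν-maximal) , (σ⊆ν , _)) =
      sym (ν-maximal μ Kμ (simplex⊆μ Kν σ⊆ν))

  module _ (noFreeFace : ∀ σ → ¬ FreeFace K σ) where

    -- Well-founded induction on proper supersets stands in for choosing a maximal simplex that
    -- avoids `v`. If `σ` avoids `v` while all larger simplices contain it, then `σ` is such a
    -- maximal choice, hence a forbidden free face.
    apex∈-acc : ∀ {σ} → Acc _⊃_ σ → Simplex K σ → StarIsCone σ → v ∈ σ
    apex∈-acc {σ} (acc rec) Kσ cone with v ∈? σ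
    ... | yes v∈σ = v∈σ
    ... | no  v∉σ = contradiction (freeFace Kσ cone v∉σ saturated) (noFreeFace σ)
      where
      saturated : ∀ {w} → Simplex K (σ ∪ ⁅ w ⁆) → w ∈ σ ∪ ⁅ v ⁆
      saturated {w} Kσw with w ∈? σ
      ... | yes w∈σ = p⊆p∪q ⁅ v ⁆ w∈σ
      ... | no  w∉σ =
        -- Since `v` lies in `σ ∪ ⁅ w ⁆` but not in `σ`, it must equal `w`.
        [ (λ v∈σ → contradiction v∈σ v∉σ)
        , (λ v∈⁅w⁆ → subst (_∈ σ ∪ ⁅ v ⁆) (x∈⁅y⁆⇒x≡y w v∈⁅w⁆) (x∈p∪⁅x⁆ σ v))
        ]′ (x∈p∪q⁻ σ ⁅ w ⁆ v∈σw)
        where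
        σ⊂σw : σ ⊂ σ ∪ ⁅ w ⁆
        σ⊂σw = p⊆p∪q ⁅ w ⁆ , w , x∈p∪⁅x⁆ σ w , w∉σ

        v∈σw : v ∈ σ ∪ ⁅ w ⁆
        v∈σw = apex∈-acc (rec σ⊂σw) Kσw
                 λ Kτ σw⊆τ → cone Kτ (⊆-trans (proj₁ σ⊂σw) σw⊆τ)

    apex∈ : ∀ {σ} → Simplex K σ → StarIsCone σ → v ∈ σ
    apex∈ = apex∈-acc (⊃-wellFounded _)

-- A witness `x` for a simplex above `γ` belongs to `ψ R? γ`, hence is related to `y`. The same `x`
-- then witnesses the simplex enlarged by `y`.
closure-starIsCone : {R : REL (Fin m) (Fin n) ℓ} (R? : Decidable R)
                     {γ : Subset n} {y : Fin n} →
                     y ∈ φ R? (ψ R? γ) → StarIsCone (Φ R) y γ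
closure-starIsCone {R = R} R? {y = y} y∈φψγ {τ} (x , τ⊆Yₓ) γ⊆τ =
  x , λ z → [ τ⊆Yₓ z , (λ z∈⁅y⁆ → subst (R x) (sym (x∈⁅y⁆⇒x≡y y z∈⁅y⁆)) Rxy) ]′
            ∘ x∈p∪q⁻ τ ⁅ y ⁆
  where
  Rxy : R x y
  Rxy = ∈-φ⁻ R? y∈φψγ (∈-ψ⁺ R? (λ z∈γ → τ⊆Yₓ _ (γ⊆τ z∈γ)))

lemma62 : {m n : ℕ} .{{_ : NonZero m}} .{{_ : NonZero n}} {ℓ : Level}
    (R : REL (Fin m) (Fin n) ℓ) (R? : Decidable R) →
    (∀ γ → ¬ FreeFace (Φ R) γ) →
    PreservesAttributePrivacy R?
lemma62 R R? noFreeFace γ Φγ = ⊆-antisym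
  -- Any attribute in the closure of `γ` is a cone apex over `γ`, and an apex cannot lie outside `γ`
  -- when free faces are absent.
  (λ {y} y∈φψγ → apex∈ (Φ R) y noFreeFace Φγ (closure-starIsCone R? y∈φψγ))
  -- This is the extensivity of the closure operator of the Galois connection between `φ` and `ψ`.
  (λ y∈γ → ∈-φ⁺ R? λ x∈ψγ → ∈-ψ⁻ R? x∈ψγ y∈γ)
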